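{- Let $G$ be a finite simple undirected graph on $n$ vertices and let $k\ge 0$ be an integer. Then $G$ is circulant of generator set $S$ for some generator set $S$ with $|S|=k$ if and only if $G$ is $k$-regular and admits an MCSD.
   Context: Graphs are finite, undirected, without multiple edges or self-loops. A graph $G$ on $n$ vertices is circulant of generator set $S$ if $S\subseteq \mathbb{Z}_n\setminus\{0\}$ is closed under inversion ($s\in S\Rightarrow -s\in S$) and the vertices of $G$ can be identified bijectively with the elements of $\mathbb{Z}_n$ in such a way that $uv\in E(G)$ if and only if $v=u+s$ (modulo $n$) for some $s\in S$. The set $S$ is not required to generate $\mathbb{Z}_n$, so $G$ may be disconnected. An edge labeling $\lambda$ of $G$ assigns to every edge $uv$ two labels, $\lambda_u(uv)$ corresponding to $u$ and $\lambda_v(uv)$ corresponding to $v$. It is a chordal sense of direction (CSD) if there is a cyclic ordering of the vertices, i.e. a bijection $r:V(G)\to\{0,\ldots,n-1\}$ (the rank), such that for every edge $uv$ the label $\lambda_u(uv)\in\{1,\ldots,n-1\}$ equals $r(v)-r(u)$ modulo $n$ (and likewise $\lambda_v(uv)$ equals $r(u)-r(v)$ modulo $n$). It is a minimal chordal sense of direction (MCSD) if moreover the total number of distinct labels used is exactly $\Delta(G)$, the maximum degree of $G$. $G$ admits an MCSD if some labeling of $G$ is an MCSD. -}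

module Defs where

open import Data.Fin.Base using (Fin; toℕ)
open import Data.Fin.Permutation using (Permutation′; _⟨$⟩ʳ_)
open import Data.Fin.Subset using (Subset; _∈_; _∉_; ∣_∣)
open import Data.List.Base using (List; []; [_]; length; map; concatMap; allFin; deduplicate)
open import Data.List.Extrema.Nat using (max)
open import Data.Nat.Base using (ℕ; NonZero; _+_; _∸_; _≤_; _<_)
open import Data.Nat.DivMod using (_mod_)
open import Data.Nat.Properties using (_≟_)
open import Data.Product.Base using (_×_; ∃-syntax)
open import Data.Vec.Base using (tabulate)
open import Function.Bundles using (_⇔_)
open import Level using (0ℓ)
open import Relation.Binary.Core using (Rel)
open import Relation.Binary.Definitions using (Decidable; Irreflexive; Symmetric)
open import Relation.Binary.PropositionalEquality.Core using (_≡_)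
open import Relation.Nullary.Decidable.Core using (does; yes; no)

record Graph (n : ℕ) : Set₁ where
  infix 4 _~_ _~?_
  field
    _~_    : Rel (Fin n) 0ℓ
    _~?_   : Decidable _~_
    sym    : Symmetric _~_
    irrefl : Irreflexive _≡_ _~_

module _ {n : ℕ} (G : Graph n) where
  open Graph G

  neighbours : Fin n → Subset n
  neighbours u = tabulate λ v → does (u ~? v)

  degree : Fin n → ℕ
  degree u = ∣ neighbours u ∣

  maxDegree : ℕ
  maxDegree = max 0 (map degree (allFin n))

  Regular : ℕ → Set
  Regular k = ∀ u → degree u ≡ k

-- The group ℤₙ, carried by Fin n.
module _ {n : ℕ} .{{_ : NonZero n}} where

  infixl 6 _⊕_ _⊖_
  infix  8 ⊖_

  0ₙ : Fin n
  0ₙ = 0 mod n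

  _⊕_ : Fin n → Fin n → Fin n
  i ⊕ j = (toℕ i + toℕ j) mod n

  ⊖_ : Fin n → Fin n
  ⊖ i = (n ∸ toℕ i) mod n

  _⊖_ : Fin n → Fin n → Fin n
  i ⊖ j = i ⊕ (⊖ j)

module _ {n : ℕ} .{{_ : NonZero n}} where

  IsGeneratorSet : Subset n → Set
  IsGeneratorSet S = 0ₙ ∉ S × (∀ {s} → s ∈ S → ⊖ s ∈ S)

  IsCirculant : Graph n → Subset n → Set
  IsCirculant G S =
    IsGeneratorSet S ×
    ∃[ φ ] (∀ u v → (u ~ v) ⇔ (∃[ s ] (s ∈ S × φ ⟨$⟩ʳ v ≡ (φ ⟨$⟩ʳ u) ⊕ s)))
    where open Graph G

module _ {n : ℕ} (G : Graph n) where
  open Graph G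

  -- ℓ u v e is the label corresponding to u on the edge uv, and ℓ v u (sym e)
  -- the one corresponding to v. Irrelevance makes a label depend on the edge
  -- only, not on the proof of adjacency.
  Labelling : Set
  Labelling = ∀ u v → .(u ~ v) → ℕ

module _ {n : ℕ} (G : Graph n) (ℓ : Labelling G) where
  open Graph G

  labelsAt : Fin n → Fin n → List ℕ
  labelsAt u v with u ~? v
  ... | yes e = [ ℓ u v e ]
  ... | no  _ = []

  usedLabels : List ℕ
  usedLabels = concatMap (λ u → concatMap (labelsAt u) (allFin n)) (allFin n)

  numLabels : ℕ
  numLabels = length (deduplicate _≟_ usedLabels)

module _ {n : ℕ} .{{_ : NonZero n}} (G : Graph n) where
  open Graph G

  -- As u and v range over ordered pairs, this constrains both labels of an edge.
  IsCSD : Labelling G → Set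
  IsCSD ℓ = ∃[ r ] (∀ u v (e : u ~ v) →
    1 ≤ ℓ u v e × ℓ u v e < n × ℓ u v e mod n ≡ (r ⟨$⟩ʳ v) ⊖ (r ⟨$⟩ʳ u))

  IsMCSD : Labelling G → Set
  IsMCSD ℓ = IsCSD ℓ × numLabels G ℓ ≡ maxDegree G

  AdmitsMCSD : Set
  AdmitsMCSD = ∃[ ℓ ] IsMCSD ℓ

{-# OPTIONS --safe #-}
-- Fix a numbering π of the vertices by ℤₙ and call π v ⊖ π u, for an edge uv, an
-- offset at u. The offsets at u are in bijection with the neighbours of u, and a
-- chordal sense of direction of rank π uses exactly the labels that are offsets
-- at some vertex. If G is k-regular, each vertex thus has k offsets, so only k
-- labels are used if and only if all vertices have the same set S of offsets;
-- that is to say, G is circulant of generator set S.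
module Submission where

open import Defs
open import Algebra.Bundles using (AbelianGroup)
import Algebra.Properties.AbelianGroup as AbelianGroupProperties
import Algebra.Properties.Group as GroupProperties
open import Data.Bool.Base using (true; false)
open import Data.Empty using (⊥-elim)
open import Data.Fin.Base using (Fin; zero; suc; toℕ)
open import Data.Fin.Permutation using (Permutation′; _⟨$⟩ʳ_; inverseʳ)
import Data.Fin.Properties as Fin
open import Data.Fin.Subset using (Subset; ∣_∣; _⊆_; _∈_; _∉_)
open import Data.Fin.Subset.Properties using (_∈?_; ⊆-antisym; p⊂q⇒∣p∣<∣q∣)
import Data.List.Base as List
open import Data.List.Base using (List; length; filter; allFin; deduplicate)
import Data.List.Extrema.Nat as Extrema
open import Data.List.Membership.Propositional using (find; lose) renaming (_∈_ to _∈ˡ_)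
open import Data.List.Membership.Propositional.Properties
  using (∈-allFin; ∈-filter⁺; ∈-filter⁻; ∈-map∘filter⁺; ∈-map∘filter⁻;
         ∈-concatMap⁺; ∈-concatMap⁻; ∈-deduplicate⁺; ∈-deduplicate⁻)
open import Data.List.Membership.Propositional.Properties.WithK using (unique∧set⇒bag)
open import Data.List.Properties using (length-map)
open import Data.List.Relation.Binary.BagAndSetEquality using (∼bag⇒↭)
open import Data.List.Relation.Binary.Permutation.Propositional.Properties using (↭-length)
import Data.List.Relation.Unary.All.Properties as All
import Data.List.Relation.Unary.Any.Properties as Any
open import Data.List.Relation.Unary.Any using (here)
open import Data.List.Relation.Unary.Unique.Propositional using (Unique)
import Data.List.Relation.Unary.Unique.Propositional.Properties as Unique
import Data.List.Relation.Unary.Unique.DecPropositional.Properties as UniqueDec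
open import Data.Nat.Base using (ℕ; NonZero; zero; suc; _+_; _∸_; _≤_; _<_; _%_; z≤n; >-nonZero⁻¹)
open import Data.Nat.DivMod
  using (_mod_; m%n<n; m<n⇒m%n≡m; n%n≡0; %-distribˡ-+)
import Data.Nat.Properties as ℕ
open import Data.Product.Base using (_×_; _,_; ∃-syntax; proj₂)
open import Data.Sum.Base using (inj₂)
open import Data.Vec.Base using (tabulate)
open import Data.Vec.Properties using (lookup∘tabulate; []=⇒lookup; lookup⇒[]=)
open import Function.Base using (_∘_; id)
open import Function.Bundles using (_⇔_; mk⇔; Equivalence; module Injection)
open import Function.Properties.Inverse using (↔⇒↣)
open import Level using (0ℓ)
open import Relation.Binary.PropositionalEquality
  using (_≡_; _≢_; refl; sym; trans; cong; cong₂; subst; isEquivalence; module ≡-Reasoning)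
open import Relation.Nullary.Decidable
  using (does; yes; no; dec-true; _×-dec_)
open import Relation.Unary using (Pred; Decidable)

-- Arithmetic modulo `n`.

module _ {n : ℕ} .{{_ : NonZero n}} where

  toℕ-mod : ∀ m → toℕ (m mod n) ≡ m % n
  toℕ-mod m = Fin.toℕ-fromℕ< (m%n<n m n)

  mod-cong-% : ∀ {l m} → l % n ≡ m % n → l mod n ≡ m mod n
  mod-cong-% {l} {m} eq =
    Fin.toℕ-injective (trans (toℕ-mod l) (trans eq (sym (toℕ-mod m))))

  toℕ-% : ∀ (i : Fin n) → toℕ i % n ≡ toℕ i
  toℕ-% i = m<n⇒m%n≡m (Fin.toℕ<n i)

  toℕ-mod-inverse : ∀ (i : Fin n) → toℕ i mod n ≡ i
  toℕ-mod-inverse i = Fin.toℕ-injective (trans (toℕ-mod (toℕ i)) (toℕ-% i))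

  -- Reduction can wait until after an addition. This carries the group laws of `ℤₙ` over from laws
  -- of `ℕ`.
  mod-⊕ˡ : ∀ l (j : Fin n) → (l mod n) ⊕ j ≡ (l + toℕ j) mod n
  mod-⊕ˡ l j = mod-cong-% (begin
    (toℕ (l mod n) + toℕ j) % n          ≡⟨ cong (λ x → (x + toℕ j) % n) (toℕ-mod l) ⟩
    (l % n + toℕ j) % n                  ≡⟨ cong (λ x → (l % n + x) % n) (toℕ-% j) ⟨
    (l % n + toℕ j % n) % n              ≡⟨ %-distribˡ-+ l (toℕ j) n ⟨
    (l + toℕ j) % n                      ∎)
    where open ≡-Reasoning

  ⊕-comm : ∀ (i j : Fin n) → i ⊕ j ≡ j ⊕ i
  ⊕-comm i j = cong (_mod n) (ℕ.+-comm (toℕ i) (toℕ j))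

  ⊕-assoc : ∀ (i j k : Fin n) → (i ⊕ j) ⊕ k ≡ i ⊕ (j ⊕ k)
  ⊕-assoc i j k = begin
    (i ⊕ j) ⊕ k                         ≡⟨ mod-⊕ˡ (toℕ i + toℕ j) k ⟩
    (toℕ i + toℕ j + toℕ k) mod n       ≡⟨ cong (_mod n) (ℕ.+-assoc (toℕ i) _ _) ⟩
    -- Reductions are absorbed on the left only, so `i` is rotated to the right end and back.
    (toℕ i + (toℕ j + toℕ k)) mod n     ≡⟨ cong (_mod n) (ℕ.+-comm (toℕ i) _) ⟩
    (toℕ j + toℕ k + toℕ i) mod n       ≡⟨ mod-⊕ˡ (toℕ j + toℕ k) i ⟨
    (j ⊕ k) ⊕ i                         ≡⟨ ⊕-comm (j ⊕ k) i ⟩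
    i ⊕ (j ⊕ k)                         ∎
    where open ≡-Reasoning

  ⊕-identityˡ : ∀ (i : Fin n) → 0ₙ ⊕ i ≡ i
  ⊕-identityˡ i = trans (mod-⊕ˡ 0 i) (toℕ-mod-inverse i)

  ⊕-inverseˡ : ∀ (i : Fin n) → (⊖ i) ⊕ i ≡ 0ₙ
  ⊕-inverseˡ i = begin
    (⊖ i) ⊕ i                      ≡⟨ mod-⊕ˡ (n ∸ toℕ i) i ⟩
    -- The truncated subtraction is exact because `toℕ i < n`.
    (n ∸ toℕ i + toℕ i) mod n      ≡⟨ cong (_mod n) (ℕ.m∸n+n≡m (ℕ.<⇒≤ (Fin.toℕ<n i))) ⟩
    n mod n                        ≡⟨ mod-cong-% (trans (n%n≡0 n) (sym 0%n≡0)) ⟩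
    0ₙ                             ∎
    where
    open ≡-Reasoning
    0%n≡0 : 0 % n ≡ 0
    0%n≡0 = m<n⇒m%n≡m (>-nonZero⁻¹ n)

  ℤₙ : AbelianGroup _ _
  ℤₙ = record
    { Carrier = Fin n
    ; _≈_ = _≡_
    ; _∙_ = _⊕_
    ; ε = 0ₙ
    ; _⁻¹ = ⊖_
    ; isAbelianGroup = record
      { isGroup = record
        { isMonoid = record
          { isSemigroup = record
            { isMagma = record { isEquivalence = isEquivalence ; ∙-cong = cong₂ _⊕_ }
            ; assoc = ⊕-assoc
            }
          ; identity = ⊕-identityˡ , λ i → trans (⊕-comm i 0ₙ) (⊕-identityˡ i)
          }
        ; inverse = ⊕-inverseˡ , λ i → trans (⊕-comm i (⊖ i)) (⊕-inverseˡ i)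
        ; ⁻¹-cong = cong (λ i → ⊖ i)
        }
      ; comm = ⊕-comm
      }
    }

  open GroupProperties (AbelianGroup.group ℤₙ) public
    using () renaming
      ( x∙y⁻¹≈ε⇒x≈y to i⊖j≡0⇒i≡j
      ; ⁻¹-anti-homo-// to ⊖-anti-homo-⊖
      ; //-rightDividesˡ to [i⊖j]⊕j≡i
      )
  open AbelianGroupProperties ℤₙ public
    using () renaming (xyx⁻¹≈y to i⊕j⊖i≡j)

  j≡i⊕d⇔d≡j⊖i : ∀ {i j d : Fin n} → (j ≡ i ⊕ d) ⇔ (d ≡ j ⊖ i)
  j≡i⊕d⇔d≡j⊖i {i} {j} {d} = mk⇔
    (λ { refl → sym (i⊕j⊖i≡j i d) })
    (λ { refl → trans (sym ([i⊖j]⊕j≡i i j)) (⊕-comm (j ⊖ i) i) })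

  ⊖-cancelʳ : ∀ {i j} (k : Fin n) → i ⊖ k ≡ j ⊖ k → i ≡ j
  ⊖-cancelʳ {i} {j} k eq =
    trans (sym ([i⊖j]⊕j≡i k i)) (trans (cong (_⊕ k) eq) ([i⊖j]⊕j≡i k j))

toℕ≡0⇒≡0ₙ : ∀ {n} .{{_ : NonZero n}} {i : Fin n} → toℕ i ≡ 0 → i ≡ 0ₙ
toℕ≡0⇒≡0ₙ {i = i} eq = trans (sym (toℕ-mod-inverse i)) (cong (_mod _) eq)

-- Counting the elements of decidable subsets.

module _ {n : ℕ} {P : Pred (Fin n) 0ℓ} (P? : Decidable P) where

  -- Built in the form of `neighbours`, so that the size of `⟦ u ~?_ ⟧` is `degree G u` by
  -- definition.
  ⟦_⟧ : Subset n
  ⟦_⟧ = tabulate (does ∘ P?)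

  ∈⟦⟧⁺ : ∀ {i} → P i → i ∈ ⟦_⟧
  ∈⟦⟧⁺ {i} p = lookup⇒[]= i _ (trans (lookup∘tabulate _ i) (dec-true (P? i) p))

  ∈⟦⟧⁻ : ∀ {i} → i ∈ ⟦_⟧ → P i
  ∈⟦⟧⁻ {i} i∈ with P? i | trans (sym (lookup∘tabulate (does ∘ P?) i)) ([]=⇒lookup i∈)
  ... | yes p | _ = p

-- The map `f` serves the induction: dropping the head of `allFin` leaves a tabulation of `suc`.
length-filter-tabulate : ∀ {m n} {P : Pred (Fin n) 0ℓ} (P? : Decidable P) (f : Fin m → Fin n) →
  length (filter P? (List.tabulate f)) ≡ ∣ ⟦ P? ∘ f ⟧ ∣
length-filter-tabulate {zero}  P? f = refl
length-filter-tabulate {suc m} P? f with does (P? (f zero))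
... | true  = cong suc (length-filter-tabulate P? (f ∘ suc))
... | false = length-filter-tabulate P? (f ∘ suc)

-- Injectivity keeps the list of images free of duplicates, and two duplicate-free lists with the
-- same members are permutations of each other.
∣⟦⟧∣≡length : ∀ {n} {A : Set} {P : Pred (Fin n) 0ℓ} (P? : Decidable P)
  {f : Fin n → A} → (∀ {i j} → f i ≡ f j → i ≡ j) →
  {xs : List A} → Unique xs → (∀ {y} → (y ∈ˡ xs) ⇔ (∃[ i ] (P i × y ≡ f i))) →
  ∣ ⟦ P? ⟧ ∣ ≡ length xs
∣⟦⟧∣≡length {n} P? {f} f-inj {xs} xs! xs⇔ = begin
  ∣ ⟦ P? ⟧ ∣                                  ≡⟨ length-filter-tabulate P? id ⟨
  length (filter P? (allFin n))               ≡⟨ length-map f (filter P? (allFin n)) ⟨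
  length (List.map f (filter P? (allFin n)))  ≡⟨ ↭-length (∼bag⇒↭ (unique∧set⇒bag
                                                   (Unique.map⁺ f-inj (Unique.filter⁺ P? (Unique.allFin⁺ n)))
                                                   xs! (mk⇔ to from))) ⟩
  length xs                                   ∎
  where
  open ≡-Reasoning
  to : ∀ {y} → y ∈ˡ List.map f (filter P? (allFin n)) → y ∈ˡ xs
  to y∈ with ∈-map∘filter⁻ f P? {xs = allFin n} y∈
  ... | i , _ , y≡fi , p = Equivalence.from xs⇔ (i , p , y≡fi)
  from : ∀ {y} → y ∈ˡ xs → y ∈ˡ List.map f (filter P? (allFin n))
  from y∈ with Equivalence.to xs⇔ y∈
  ... | i , p , y≡fi = ∈-map∘filter⁺ f P? (i , ∈-allFin i , y≡fi , p)

-- A proper subset would be strictly smaller.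
⊆∧∣∣≤⇒⊇ : ∀ {n} {p q : Subset n} → p ⊆ q → ∣ q ∣ ≤ ∣ p ∣ → q ⊆ p
⊆∧∣∣≤⇒⊇ {p = p} p⊆q ∣q∣≤∣p∣ {x} x∈q with x ∈? p
... | yes x∈p = x∈p
... | no  x∉p = ⊥-elim (ℕ.<⇒≱ (p⊂q⇒∣p∣<∣q∣ (p⊆q , x , x∈q , x∉p)) ∣q∣≤∣p∣)

permutation-injective : ∀ {n} (π : Permutation′ n) {i j} → π ⟨$⟩ʳ i ≡ π ⟨$⟩ʳ j → i ≡ j
permutation-injective π = Injection.injective (↔⇒↣ π)

-- Maximum degree and used labels.

module _ {n : ℕ} (G : Graph n) where
  open Graph G hiding (sym)

  regular⇒maxDegree : .{{_ : NonZero n}} → ∀ {k} → Regular G k → maxDegree G ≡ k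
  regular⇒maxDegree reg = ℕ.≤-antisym
    -- `z≤n` bounds the default value 0 of `max`. For the other inequality, `0ₙ` is a vertex that
    -- attains `k`.
    (Extrema.max≤v⁺ z≤n (All.map⁺ (All.tabulate⁺ (ℕ.≤-reflexive ∘ reg))))
    (Extrema.v≤max⁺ 0 _ (inj₂ (Any.map⁺ (Any.tabulate⁺ 0ₙ (ℕ.≤-reflexive (sym (reg 0ₙ)))))))

  module _ (ℓ : Labelling G) where

    ∈-labelsAt⁺ : ∀ {u v} (e : u ~ v) → ℓ u v e ∈ˡ labelsAt G ℓ u v
    ∈-labelsAt⁺ {u} {v} e with u ~? v
    -- The proof found by `_~?_` may differ from `e`, but labels are irrelevant in it.
    ... | yes _ = here refl
    ... | no ¬e = ⊥-elim (¬e e)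

    ∈-labelsAt⁻ : ∀ {u v y} → y ∈ˡ labelsAt G ℓ u v → ∃[ e ] (y ≡ ℓ u v e)
    ∈-labelsAt⁻ {u} {v} y∈ with u ~? v
    ∈-labelsAt⁻ (here y≡) | yes e = e , y≡

    ∈-usedLabels⁺ : ∀ {u v} (e : u ~ v) → ℓ u v e ∈ˡ usedLabels G ℓ
    ∈-usedLabels⁺ {u} {v} e =
      ∈-concatMap⁺ _ (lose (∈-allFin u) (∈-concatMap⁺ _ (lose (∈-allFin v) (∈-labelsAt⁺ e))))

    ∈-usedLabels⁻ : ∀ {y} → y ∈ˡ usedLabels G ℓ → ∃[ u ] ∃[ v ] ∃[ e ] (y ≡ ℓ u v e)
    ∈-usedLabels⁻ y∈
      with u , _ , y∈u  ← find (∈-concatMap⁻ _ {xs = allFin n} y∈)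
      with v , _ , y∈uv ← find (∈-concatMap⁻ (labelsAt G ℓ u) {xs = allFin n} y∈u)
      = u , v , ∈-labelsAt⁻ y∈uv

-- Offsets of a numbered graph.

module _ {n : ℕ} .{{_ : NonZero n}} (G : Graph n) (π : Permutation′ n) where
  open Graph G hiding (sym)

  offset : Fin n → Fin n → Fin n
  offset u v = (π ⟨$⟩ʳ v) ⊖ (π ⟨$⟩ʳ u)

  offset-injective : ∀ u {v w} → offset u v ≡ offset u w → v ≡ w
  offset-injective u eq = permutation-injective π (⊖-cancelʳ (π ⟨$⟩ʳ u) eq)

  IsOffsetAt : Fin n → Pred (Fin n) 0ℓ
  IsOffsetAt u d = ∃[ v ] (u ~ v × d ≡ offset u v)

  isOffsetAt? : ∀ u → Decidable (IsOffsetAt u)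
  isOffsetAt? u d = Fin.any? (λ v → (u ~? v) ×-dec (d Fin.≟ offset u v))

  IsOffset : Pred (Fin n) 0ℓ
  IsOffset d = ∃[ u ] (IsOffsetAt u d)

  isOffset? : Decidable IsOffset
  isOffset? d = Fin.any? (λ u → isOffsetAt? u d)

  offsetsAt : Fin n → Subset n
  offsetsAt u = ⟦ isOffsetAt? u ⟧

  offsets : Subset n
  offsets = ⟦ isOffset? ⟧

  -- As `offset u` is injective, the neighbours of `u` are as many as the entries of `allFin n` that
  -- pass `isOffsetAt? u`.
  degree≡∣offsetsAt∣ : ∀ u → degree G u ≡ ∣ offsetsAt u ∣
  degree≡∣offsetsAt∣ u = trans
    (∣⟦⟧∣≡length (u ~?_) (offset-injective u) (Unique.filter⁺ (isOffsetAt? u) (Unique.allFin⁺ n))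
      (mk⇔ (proj₂ ∘ ∈-filter⁻ (isOffsetAt? u) {xs = allFin n})
           (∈-filter⁺ (isOffsetAt? u) (∈-allFin _))))
    (length-filter-tabulate (isOffsetAt? u) id)

  -- Since `π` is injective, a zero offset would make the edge a loop.
  offset≢0 : ∀ {u v} → u ~ v → offset u v ≢ 0ₙ
  offset≢0 u~v eq =
    irrefl (sym (permutation-injective π (i⊖j≡0⇒i≡j _ _ eq))) u~v

  module _ (ℓ : Labelling G) (ℓ≡ : ∀ u v (e : u ~ v) → ℓ u v e ≡ toℕ (offset u v)) where

    -- The labels are the images of the offsets under the injection `toℕ`.
    numLabels≡∣offsets∣ : numLabels G ℓ ≡ ∣ offsets ∣
    numLabels≡∣offsets∣ = sym (∣⟦⟧∣≡length isOffset? Fin.toℕ-injective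
      (UniqueDec.deduplicate-! ℕ._≟_ (usedLabels G ℓ)) (mk⇔ to from))
      where
      to : ∀ {y} → y ∈ˡ deduplicate ℕ._≟_ (usedLabels G ℓ) → ∃[ d ] (IsOffset d × y ≡ toℕ d)
      to y∈ with ∈-usedLabels⁻ G ℓ (∈-deduplicate⁻ ℕ._≟_ _ y∈)
      ... | u , v , e , refl = offset u v , (u , v , e , refl) , ℓ≡ u v e
      from : ∀ {y} → ∃[ d ] (IsOffset d × y ≡ toℕ d) → y ∈ˡ deduplicate ℕ._≟_ (usedLabels G ℓ)
      from (_ , (u , v , e , refl) , refl) = ∈-deduplicate⁺ ℕ._≟_
        (subst (_∈ˡ usedLabels G ℓ) (ℓ≡ u v e) (∈-usedLabels⁺ G ℓ e))

theorem11 : ∀ (n : ℕ) .{{_ : NonZero n}} (G : Graph n) (k : ℕ) →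
    (∃[ S ] (IsCirculant G S × ∣ S ∣ ≡ k)) ⇔ (Regular G k × AdmitsMCSD G)
theorem11 n G k = mk⇔ to from
  where
  open Graph G renaming (sym to ~-sym)

  -- The identification `φ` with `ℤₙ` itself serves as the rank.
  to : ∃[ S ] (IsCirculant G S × ∣ S ∣ ≡ k) → Regular G k × AdmitsMCSD G
  to (S , (_ , φ , ~⇔) , refl) =
    regular , ℓ , (φ , csd) , trans (numLabels≡∣offsets∣ G φ ℓ λ _ _ _ → refl)
      (trans (cong ∣_∣ offsets≡S) (sym (regular⇒maxDegree G regular)))
    where
    isOffsetAt⇒∈ : ∀ {u d} → IsOffsetAt G φ u d → d ∈ S
    isOffsetAt⇒∈ {u} (v , u~v , refl) with Equivalence.to (~⇔ u v) u~v
    ... | s , s∈S , φv≡ = subst (_∈ S) (Equivalence.to j≡i⊕d⇔d≡j⊖i φv≡) s∈S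

    ∈⇒isOffsetAt : ∀ {d} u → d ∈ S → IsOffsetAt G φ u d
    ∈⇒isOffsetAt {d} u d∈S =
      -- The neighbour is the preimage under `φ` of `(φ ⟨$⟩ʳ u) ⊕ d`.
      _ , Equivalence.from (~⇔ u _) (d , d∈S , inverseʳ φ)
        , Equivalence.to j≡i⊕d⇔d≡j⊖i (inverseʳ φ)

    offsetsAt≡S : ∀ u → offsetsAt G φ u ≡ S
    offsetsAt≡S u = ⊆-antisym
      (isOffsetAt⇒∈ ∘ ∈⟦⟧⁻ (isOffsetAt? G φ u))
      (∈⟦⟧⁺ (isOffsetAt? G φ u) ∘ ∈⇒isOffsetAt u)

    offsets≡S : offsets G φ ≡ S
    offsets≡S = ⊆-antisym
      (isOffsetAt⇒∈ ∘ proj₂ ∘ ∈⟦⟧⁻ (isOffset? G φ))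
      -- Elements of `S` are offsets at every vertex, so any vertex would do for `0ₙ`.
      (λ d∈S → ∈⟦⟧⁺ (isOffset? G φ) (0ₙ , ∈⇒isOffsetAt 0ₙ d∈S))

    regular : Regular G ∣ S ∣
    regular u = trans (degree≡∣offsetsAt∣ G φ u) (cong ∣_∣ (offsetsAt≡S u))

    ℓ : Labelling G
    ℓ u v _ = toℕ (offset G φ u v)

    csd : ∀ u v (e : u ~ v) → 1 ≤ ℓ u v e × ℓ u v e < n × ℓ u v e mod n ≡ offset G φ u v
    csd u v e = ℕ.n≢0⇒n>0 (λ eq → offset≢0 G φ e (toℕ≡0⇒≡0ₙ eq))
              , Fin.toℕ<n (offset G φ u v) , toℕ-mod-inverse (offset G φ u v)

  -- The generator set is the set of all offsets with respect to the rank `r`.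
  from : Regular G k × AdmitsMCSD G → ∃[ S ] (IsCirculant G S × ∣ S ∣ ≡ k)
  from (regular , ℓ , (r , csd) , numLabels≡) =
    offsets G r , ((0∉ , ⊖-closed) , r , λ u v → mk⇔ ~⇒ ~⇐) , ∣offsets∣≡k
    where
    -- A label below `n` is its own residue, so its congruence determines it.
    ℓ≡ : ∀ u v (e : u ~ v) → ℓ u v e ≡ toℕ (offset G r u v)
    ℓ≡ u v e with csd u v e
    ... | _ , ℓ<n , ℓmod≡ = trans (sym (m<n⇒m%n≡m ℓ<n)) (trans (sym (toℕ-mod _)) (cong toℕ ℓmod≡))

    ∣offsets∣≡k : ∣ offsets G r ∣ ≡ k
    ∣offsets∣≡k = trans (sym (numLabels≡∣offsets∣ G r ℓ ℓ≡))
      (trans numLabels≡ (regular⇒maxDegree G regular))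

    -- Minimality and regularity meet here: the offsets at `u` lie among all offsets, and both sets
    -- have `k` elements, so they coincide.
    ∈⇒isOffsetAt : ∀ {d} u → d ∈ offsets G r → IsOffsetAt G r u d
    ∈⇒isOffsetAt u = ∈⟦⟧⁻ (isOffsetAt? G r u) ∘ ⊆∧∣∣≤⇒⊇
      (λ d∈ → ∈⟦⟧⁺ (isOffset? G r) (u , ∈⟦⟧⁻ (isOffsetAt? G r u) d∈))
      (ℕ.≤-reflexive (trans ∣offsets∣≡k (trans (sym (regular u)) (degree≡∣offsetsAt∣ G r u))))

    offset∈ : ∀ {u v} → u ~ v → offset G r u v ∈ offsets G r
    offset∈ u~v = ∈⟦⟧⁺ (isOffset? G r) (_ , _ , u~v , refl)

    0∉ : 0ₙ ∉ offsets G r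
    0∉ 0∈ with ∈⇒isOffsetAt 0ₙ 0∈
    ... | _ , u~v , 0≡ = offset≢0 G r u~v (sym 0≡)

    ⊖-closed : ∀ {s} → s ∈ offsets G r → ⊖ s ∈ offsets G r
    ⊖-closed s∈ with ∈⟦⟧⁻ (isOffset? G r) s∈
    -- Seen from its other end, an edge has the opposite offset.
    ... | u , v , u~v , refl =
      subst (_∈ offsets G r) (sym (⊖-anti-homo-⊖ (r ⟨$⟩ʳ v) (r ⟨$⟩ʳ u))) (offset∈ (~-sym u~v))

    ~⇒ : ∀ {u v} → u ~ v → ∃[ s ] (s ∈ offsets G r × r ⟨$⟩ʳ v ≡ (r ⟨$⟩ʳ u) ⊕ s)
    ~⇒ u~v = _ , offset∈ u~v , Equivalence.from j≡i⊕d⇔d≡j⊖i refl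

    ~⇐ : ∀ {u v} → ∃[ s ] (s ∈ offsets G r × r ⟨$⟩ʳ v ≡ (r ⟨$⟩ʳ u) ⊕ s) → u ~ v
    -- As an offset at `u`, `s` leads to some neighbour `w`. Since `s` is also `offset G r u v`,
    -- injectivity forces `w ≡ v`.
    ~⇐ {u} (s , s∈ , rv≡) with ∈⇒isOffsetAt u s∈
    ... | w , u~w , s≡ = subst (u ~_)
      (offset-injective G r u (trans (sym s≡) (Equivalence.to j≡i⊕d⇔d≡j⊖i rv≡))) u~w
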